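{- Let $\Phi_1$ and $\Phi_2$ be implicit set systems such that there exists an isometric reduction $(f,\{g_I\})$ from $\Phi_1$ to $\Phi_2$. Suppose there exists an algorithm that solves the $(C_1,C_2)$-Diverse-$\Phi_2$-Min problem on input instance $I$ and $s\in\mathbb N$ in time $\tau(n,s,|I|)$. Then, given an instance $I_1$ of $\Phi_1$ and $s\in\mathbb N$, there exists an algorithm for $(C_1,C_2)$-Diverse-$\Phi_1$-Min running in time $\tau_f+\tau(n,s,|f(I_1)|)+\tau_{g_{I_2}}$, where $I_2=f(I_1)$ and $\tau_f$, $\tau_{g_{I}}$ denote the time it takes to compute the functions $f$ and $g_I$.
   Context: An implicit set system $\Phi$ is a function that takes a string $I\in\{0,1\}^*$ (an instance) and outputs an integer $n\in\mathbb N$ and a family $\mathcal F_I\subseteq\{0,1\}^n$ (the feasible set). Elements of $\{0,1\}^n$ are identified with subsets of $[n]$; $|A|$ is Hamming weight (size), $d_H$ is Hamming distance. $\mathrm{OPT}_{\Phi\text{ -Min}}(I)$ is the smallest weight of an element of $\mathcal F_I$ and $\mathcal F_{I,\min}\subseteq\mathcal F_I$ is the set of elements of smallest weight. For a set $S$, $\mathrm{minPD}(S)=\min_{z_1\neq z_2\in S}d_H(z_1,z_2)$. For $C_1\ge1$, $C_2\le 1$, the problem $(C_1,C_2)$-Diverse-$\Phi$-Min: given an instance $I$ of $\Phi$ and $s\in\mathbb N$, output $S^*\subseteq\mathcal F_I$ with $s$ elements such that every $z\in S^*$ has weight at most $C_1\cdot\mathrm{OPT}_{\Phi\text{ -Min}}(I)$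 and $\mathrm{minPD}(S^*)\ge C_2\cdot\max_{S\subseteq\mathcal F_{I,\min},|S|=s}\mathrm{minPD}(S)$. An isometric reduction from $\Phi_1$ to $\Phi_2$ is given by a computable function $f$ and a family of computable functions $\{g_I\}$, one for every instance $I$ of $\Phi_2$. The function $f$ takes an instance $I_1$ of $\Phi_1$ with $\Phi_1(I_1)=(n_1,\mathcal F_1)$ and outputs an instance $I_2$ of $\Phi_2$ with $\Phi_2(I_2)=(n_2,\mathcal F_2)$ such that $n_2=n_1$ and $|\mathcal F_2|=|\mathcal F_1|$. The function $g_{I_2}$ is a bijection $g_{I_2}:\mathcal F_2\to\mathcal F_1$ such that $|A|=|g_{I_2}(A)|$ for each $A\in\mathcal F_2$, and $d_H(A_1,A_2)=d_H(g_{I_2}(A_1),g_{I_2}(A_2))$ for all $A_1,A_2\in\mathcal F_2$. Here $\tau_{g_{I_2}}$ is the time to apply $g_{I_2}$ to the elements of the computed solution set. -}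

module Defs where

open import Level using (_⊔_) renaming (suc to lsuc)
open import Algebra.Bundles using (CommutativeRing)
import Algebra.Properties.Semiring.Mult as Mult
open import Data.Bool.Base using (Bool; true; false; T; _xor_)
open import Data.Fin.Base using (Fin; zero; suc; lift)
open import Data.Fin.Subset using (Subset; inside; outside; ∣_∣)
open import Data.List.Base
  using (List; []; _∷_; _++_; length; map; filterᵇ; reverse; _ʳ++_)
open import Data.List.Membership.Propositional using (_∈_)
open import Data.List.Relation.Binary.Permutation.Propositional using (_↭_)
open import Data.List.Relation.Binary.Permutation.Propositional.Properties
  using (↭-reverse)
open import Data.List.Relation.Unary.All using (All)
open import Data.List.Relation.Unary.Unique.Propositional using (Unique)
open import Data.Nat.Base using (ℕ; zero; suc; _+_; _≤_)
open import Data.Nat.Binary.Base using (ℕᵇ; zero; 2[1+_]; 1+[2_]; fromℕ)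
open import Data.Nat.Properties using (≤-refl)
open import Data.Product.Base using (Σ; ∃; ∃-syntax; _×_; _,_; proj₁; proj₂)
open import Data.Vec.Base as Vec using (Vec; []; _∷_; lookup; zipWith; toList)
open import Function.Definitions using (Bijective)
open import Relation.Binary.Core using (Rel)
open import Relation.Binary.PropositionalEquality using (_≡_; _≢_; refl; cong; subst)
open import Relation.Binary.Structures using (IsPartialOrder)

------------------------------------------------------------------------
-- Model of computation
--
-- Programs manipulate binary trees, as in Jones's WHILE language ("Computability
-- and Complexity from a Programming Perspective"), with single-assignment
-- variables: Exp n is a program with n input variables.  Every constant,
-- constructor, selector and test costs one step.  Naming a value (let) and
-- referring to a named value (var) are free, so a program run costs within a
-- constant factor, fixed by the program text, of the number of evaluation
-- steps; each loop iteration costs at least one.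

data Tree : Set where
  leaf : Tree
  node : Tree → Tree → Tree

left right : Tree → Tree
left  leaf       = leaf
left  (node a _) = a
right leaf       = leaf
right (node _ b) = b

-- while e c b : starting from the value v of e, replace v by the value of b at
-- v for as long as the value of c at v is not leaf; the result is the final v.
data Exp (n : ℕ) : Set where
  var           : Fin n → Exp n
  nil           : Exp n
  cons          : Exp n → Exp n → Exp n
  hd tl         : Exp n → Exp n
  if_then_else_ : Exp n → Exp n → Exp n → Exp n
  let′          : Exp n → Exp (suc n) → Exp n
  while         : Exp n → Exp (suc n) → Exp (suc n) → Exp n

infix 4 _⊢_⇓_∣_ _⊢loop_,_from_⇓_∣_

mutual

  -- ρ ⊢ e ⇓ v ∣ t : on inputs ρ the program e halts with output v after t steps.
  data _⊢_⇓_∣_ {n : ℕ} (ρ : Vec Tree n) : Exp n → Tree → ℕ → Set where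
    ⇓var   : ∀ {x} → ρ ⊢ var x ⇓ lookup ρ x ∣ 0
    ⇓nil   : ρ ⊢ nil ⇓ leaf ∣ 1
    ⇓cons  : ∀ {e₁ e₂ v₁ v₂ t₁ t₂} →
             ρ ⊢ e₁ ⇓ v₁ ∣ t₁ → ρ ⊢ e₂ ⇓ v₂ ∣ t₂ →
             ρ ⊢ cons e₁ e₂ ⇓ node v₁ v₂ ∣ suc (t₁ + t₂)
    ⇓hd    : ∀ {e v t} → ρ ⊢ e ⇓ v ∣ t → ρ ⊢ hd e ⇓ left v ∣ suc t
    ⇓tl    : ∀ {e v t} → ρ ⊢ e ⇓ v ∣ t → ρ ⊢ tl e ⇓ right v ∣ suc t
    ⇓then  : ∀ {c e₁ e₂ a b v t₁ t₂} →
             ρ ⊢ c ⇓ node a b ∣ t₁ → ρ ⊢ e₁ ⇓ v ∣ t₂ →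
             ρ ⊢ if c then e₁ else e₂ ⇓ v ∣ suc (t₁ + t₂)
    ⇓else  : ∀ {c e₁ e₂ v t₁ t₂} →
             ρ ⊢ c ⇓ leaf ∣ t₁ → ρ ⊢ e₂ ⇓ v ∣ t₂ →
             ρ ⊢ if c then e₁ else e₂ ⇓ v ∣ suc (t₁ + t₂)
    ⇓let   : ∀ {e₁ e₂ v₁ v₂ t₁ t₂} →
             ρ ⊢ e₁ ⇓ v₁ ∣ t₁ → (v₁ ∷ ρ) ⊢ e₂ ⇓ v₂ ∣ t₂ →
             ρ ⊢ let′ e₁ e₂ ⇓ v₂ ∣ t₁ + t₂
    ⇓while : ∀ {e c b v w t₁ t₂} →
             ρ ⊢ e ⇓ v ∣ t₁ → ρ ⊢loop c , b from v ⇓ w ∣ t₂ →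
             ρ ⊢ while e c b ⇓ w ∣ t₁ + t₂

  data _⊢loop_,_from_⇓_∣_ {n : ℕ} (ρ : Vec Tree n) (c b : Exp (suc n)) :
       Tree → Tree → ℕ → Set where
    stop : ∀ {v t} →
           (v ∷ ρ) ⊢ c ⇓ leaf ∣ t →
           ρ ⊢loop c , b from v ⇓ v ∣ suc t
    step : ∀ {v x y v′ w t₁ t₂ t₃} →
           (v ∷ ρ) ⊢ c ⇓ node x y ∣ t₁ →
           (v ∷ ρ) ⊢ b ⇓ v′ ∣ t₂ →
           ρ ⊢loop c , b from v′ ⇓ w ∣ t₃ →
           ρ ⊢loop c , b from v ⇓ w ∣ suc (t₁ + t₂ + t₃)

RunsWithin : ∀ {n} → Exp n → Vec Tree n → Tree → ℕ → Set
RunsWithin p ρ v bound = ∃[ t ] t ≤ bound × ρ ⊢ p ⇓ v ∣ t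

encList : ∀ {a} {A : Set a} → (A → Tree) → List A → Tree
encList enc []       = leaf
encList enc (x ∷ xs) = node (enc x) (encList enc xs)

encBool : Bool → Tree
encBool false = leaf
encBool true  = node leaf leaf

encBits : List Bool → Tree
encBits = encList encBool

encSubset : ∀ {n} → Subset n → Tree
encSubset A = encBits (toList A)

encFamily : ∀ {n} → List (Subset n) → Tree
encFamily = encList encSubset

-- Numbers are presented to programs in (bijective) binary.
encℕᵇ : ℕᵇ → Tree
encℕᵇ zero     = leaf
encℕᵇ 2[1+ n ] = node leaf (encℕᵇ n)
encℕᵇ 1+[2 n ] = node (node leaf leaf) (encℕᵇ n)

encℕ : ℕ → Tree
encℕ s = encℕᵇ (fromℕ s)

------------------------------------------------------------------------
-- Implicit set systems

Instance : Set
Instance = List Bool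

record SetSystem : Set where
  field
    size   : Instance → ℕ
    family : (I : Instance) → Subset (size I) → Bool

  Feasible : Instance → Set
  Feasible I = Σ (Subset (size I)) λ A → T (family I A)

subsets : ∀ n → List (Subset n)
subsets zero    = [] ∷ []
subsets (suc n) = map (inside ∷_) (subsets n) ++ map (outside ∷_) (subsets n)

cardinality : ∀ {n} → (Subset n → Bool) → ℕ
cardinality {n} F = length (filterᵇ F (subsets n))

hamming : ∀ {n} → Subset n → Subset n → ℕ
hamming A B = ∣ zipWith _xor_ A B ∣

IsMin IsMax : (ℕ → Set) → ℕ → Set
IsMin P m = P m × (∀ {k} → P k → m ≤ k)
IsMax P m = P m × (∀ {k} → P k → k ≤ m)

-- A set of fewer than two elements has no pair z₁ ≢ z₂ to minimise over, hence
-- no minPD (the minimum over the empty set being +∞).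
IsMinPD : ∀ {n} → List (Subset n) → ℕ → Set
IsMinPD S = IsMin λ d →
  ∃[ z₁ ] ∃[ z₂ ] z₁ ∈ S × z₂ ∈ S × z₁ ≢ z₂ × d ≡ hamming z₁ z₂

module _ (Φ : SetSystem) (I : Instance) where
  open SetSystem Φ

  elements : List (Feasible I) → List (Subset (size I))
  elements = map proj₁

  IsOPT : ℕ → Set
  IsOPT = IsMin λ k → ∃[ A ] T (family I A) × k ≡ ∣ A ∣

  IsMinimum : Feasible I → Set
  IsMinimum (A , _) = IsOPT ∣ A ∣

  -- Finite sets are duplicate-free lists.
  SubsetOfMinima : ℕ → List (Feasible I) → Set
  SubsetOfMinima s S = Unique S × length S ≡ s × All IsMinimum S

  IsMaxMinPD : ℕ → ℕ → Set
  IsMaxMinPD s = IsMax λ d → ∃[ S ] SubsetOfMinima s S × IsMinPD (elements S) d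

------------------------------------------------------------------------
-- The approximation factors are taken from an arbitrary ordered commutative
-- ring, so as to cover every construction of the real numbers.

record OrderedRing c ℓ₁ ℓ₂ : Set (lsuc (c ⊔ ℓ₁ ⊔ ℓ₂)) where
  field
    commutativeRing : CommutativeRing c ℓ₁

  open CommutativeRing commutativeRing public
    using (Carrier; _≈_; 0#; 1#; semiring)
    renaming (_+_ to _+ᴿ_; _*_ to _*ᴿ_)

  infix 4 _≤ᴿ_
  field
    _≤ᴿ_           : Rel Carrier ℓ₂
    isPartialOrder : IsPartialOrder _≈_ _≤ᴿ_
    0≤1            : 0# ≤ᴿ 1#
    +-mono         : ∀ {w x y z} → w ≤ᴿ x → y ≤ᴿ z → w +ᴿ y ≤ᴿ x +ᴿ z
    *-nonneg       : ∀ {x y} → 0# ≤ᴿ x → 0# ≤ᴿ y → 0# ≤ᴿ x *ᴿ y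

  ι : ℕ → Carrier
  ι n = Mult._×_ semiring n 1#

------------------------------------------------------------------------
-- Diverse minimisation

module _ {c ℓ₁ ℓ₂} (R : OrderedRing c ℓ₁ ℓ₂) where
  open OrderedRing R

  record IsDiverseSolution (C₁ C₂ : Carrier) (Φ : SetSystem) (I : Instance) (s : ℕ)
                           (S : List (SetSystem.Feasible Φ I)) : Set ℓ₂ where
    field
      distinct  : Unique S
      count     : length S ≡ s
      light     : ∀ {z opt} → z ∈ elements Φ I S → IsOPT Φ I opt →
                  ι ∣ z ∣ ≤ᴿ C₁ *ᴿ ι opt
      diverse   : ∀ {d m} → IsMinPD (elements Φ I S) d → IsMaxMinPD Φ I s m →
                  C₂ *ᴿ ι m ≤ᴿ ι d

  -- An algorithm with time bound `time`.  The maximum in the diversity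
  -- requirement ranges over the s-element sets of minimum-weight solutions, so
  -- inputs (I , s) without such a set are outside the problem; there nothing is
  -- required, and the value of `output` is irrelevant.
  record DiverseAlgorithm (C₁ C₂ : Carrier) (Φ : SetSystem)
                          (time : Instance → ℕ → ℕ) : Set ℓ₂ where
    open SetSystem Φ
    field
      program : Exp 2
      output  : (I : Instance) → ℕ → List (Feasible I)
      runs    : ∀ I s → ∃ (SubsetOfMinima Φ I s) →
                RunsWithin program (encBits I ∷ encℕ s ∷ [])
                  (encFamily (elements Φ I (output I s))) (time I s)
      correct : ∀ I s → ∃ (SubsetOfMinima Φ I s) →
                IsDiverseSolution C₁ C₂ Φ I s (output I s)

------------------------------------------------------------------------
-- Isometric reductions

InstanceMap : Set
InstanceMap = Instance → Instance

-- The values g I A are bit strings of length size I: a feasible set of I may be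
-- matched with that of any I₁ sent to I, once the two lengths are identified.
SolutionMap : SetSystem → Set
SolutionMap Φ = (I : Instance) → Feasible I → Subset (size I)
  where open SetSystem Φ

ComputableWithin : InstanceMap → (Instance → ℕ) → Set
ComputableWithin f τ = ∃[ p ] ∀ I → RunsWithin p (encBits I ∷ []) (encBits (f I)) (τ I)

-- One program computes the whole family, given I together with the argument.
ComputableFamilyWithin : (Φ : SetSystem) → SolutionMap Φ →
                         ((I : Instance) → SetSystem.Feasible Φ I → ℕ) → Set
ComputableFamilyWithin Φ g τ =
  ∃[ p ] ∀ I A →
    RunsWithin p (encBits I ∷ encSubset (proj₁ A) ∷ []) (encSubset (g I A)) (τ I A)

-- τ I S bounds the time to apply g I to all elements of the set S; the images
-- may be listed in any order.
ApplicableWithin : (Φ : SetSystem) → SolutionMap Φ →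
                   ((I : Instance) → List (SetSystem.Feasible Φ I) → ℕ) → Set
ApplicableWithin Φ g τ =
  ∃[ p ] ∀ I S → ∃[ U ] U ↭ map (g I) S ×
    RunsWithin p (encBits I ∷ encFamily (elements Φ I S) ∷ []) (encFamily U) (τ I S)

record IsometricReduction (Φ₁ Φ₂ : SetSystem) : Set where
  open SetSystem Φ₁ using ()
    renaming (size to size₁; family to family₁; Feasible to Feasible₁)
  open SetSystem Φ₂ using ()
    renaming (size to size₂; family to family₂; Feasible to Feasible₂)
  field
    f            : InstanceMap
    g            : SolutionMap Φ₂
    f-computable : ∃ (ComputableWithin f)
    g-computable : ∃ (ComputableFamilyWithin Φ₂ g)
    size-≡       : ∀ I₁ → size₂ (f I₁) ≡ size₁ I₁
    cardinality-≡ : ∀ I₁ → cardinality (family₂ (f I₁)) ≡ cardinality (family₁ I₁)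
    g-feasible   : ∀ I₁ (A : Feasible₂ (f I₁)) →
                   T (family₁ I₁ (Vec.cast (size-≡ I₁) (g (f I₁) A)))

  g↓ : ∀ I₁ → Feasible₂ (f I₁) → Feasible₁ I₁
  g↓ I₁ A = Vec.cast (size-≡ I₁) (g (f I₁) A) , g-feasible I₁ A

  field
    g-bijective : ∀ I₁ → Bijective _≡_ _≡_ (g↓ I₁)
    g-weight    : ∀ I₁ (A : Feasible₂ (f I₁)) →
                  ∣ proj₁ A ∣ ≡ ∣ proj₁ (g↓ I₁ A) ∣
    g-isometric : ∀ I₁ (A B : Feasible₂ (f I₁)) →
                  hamming (proj₁ A) (proj₁ B) ≡
                  hamming (proj₁ (g↓ I₁ A)) (proj₁ (g↓ I₁ B))

------------------------------------------------------------------------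
-- A computable family can be applied to finite sets: the time bound required
-- by ApplicableWithin always exists.

rename : ∀ {m n} → (Fin m → Fin n) → Exp m → Exp n
rename r (var x)                = var (r x)
rename r nil                    = nil
rename r (cons e₁ e₂)           = cons (rename r e₁) (rename r e₂)
rename r (hd e)                 = hd (rename r e)
rename r (tl e)                 = tl (rename r e)
rename r (if c then e₁ else e₂) = if rename r c then rename r e₁ else rename r e₂
rename r (let′ e₁ e₂)           = let′ (rename r e₁) (rename (lift 1 r) e₂)
rename r (while e c b)          =
  while (rename r e) (rename (lift 1 r) c) (rename (lift 1 r) b)

Agrees : ∀ {m n} → (Fin m → Fin n) → Vec Tree m → Vec Tree n → Set
Agrees r ρ σ = ∀ x → lookup σ (r x) ≡ lookup ρ x

lift-agrees : ∀ {m n} {r : Fin m → Fin n} {ρ σ} {v : Tree} →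
              Agrees r ρ σ → Agrees (lift 1 r) (v ∷ ρ) (v ∷ σ)
lift-agrees a zero    = refl
lift-agrees a (suc x) = a x

mutual

  rename-⇓ : ∀ {m n} {r : Fin m → Fin n} {ρ σ e v t} → Agrees r ρ σ →
             ρ ⊢ e ⇓ v ∣ t → σ ⊢ rename r e ⇓ v ∣ t
  rename-⇓ {r = r} {σ = σ} a (⇓var {x}) =
    subst (σ ⊢ var (r x) ⇓_∣ 0) (a x) ⇓var
  rename-⇓ a ⇓nil         = ⇓nil
  rename-⇓ a (⇓cons p q)  = ⇓cons (rename-⇓ a p) (rename-⇓ a q)
  rename-⇓ a (⇓hd p)      = ⇓hd (rename-⇓ a p)
  rename-⇓ a (⇓tl p)      = ⇓tl (rename-⇓ a p)
  rename-⇓ a (⇓then p q)  = ⇓then (rename-⇓ a p) (rename-⇓ a q)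
  rename-⇓ a (⇓else p q)  = ⇓else (rename-⇓ a p) (rename-⇓ a q)
  rename-⇓ a (⇓let p q)   = ⇓let (rename-⇓ a p) (rename-⇓ (lift-agrees a) q)
  rename-⇓ a (⇓while p l) = ⇓while (rename-⇓ a p) (rename-loop a l)

  rename-loop : ∀ {m n} {r : Fin m → Fin n} {ρ σ c b v w t} → Agrees r ρ σ →
                ρ ⊢loop c , b from v ⇓ w ∣ t →
                σ ⊢loop rename (lift 1 r) c , rename (lift 1 r) b from v ⇓ w ∣ t
  rename-loop a (stop p)     = stop (rename-⇓ (lift-agrees a) p)
  rename-loop a (step p q l) =
    step (rename-⇓ (lift-agrees a) p) (rename-⇓ (lift-agrees a) q) (rename-loop a l)

-- The loop state is the pair of the arguments still to be treated and the
-- images found so far.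
module _ (p : Exp 2) where

  private
    argument : Fin 2 → Fin 4
    argument zero       = suc (suc zero)
    argument (suc zero) = zero

    loopBody : Exp 3
    loopBody = cons (tl (hd (var zero)))
                    (cons (let′ (hd (hd (var zero))) (rename argument p))
                          (tl (var zero)))

  applyAll : Exp 2
  applyAll = tl (while (cons (var (suc zero)) nil) (hd (var zero)) loopBody)

  module _ {A B : Set} (encA : A → Tree) (encB : B → Tree) (h : A → B) {i l : Tree}
           (p-computes : ∀ x → ∃[ t ] (i ∷ encA x ∷ []) ⊢ p ⇓ encB (h x) ∣ t) where

    private
      args : ∀ {v : Tree} x →
             Agrees argument (i ∷ encA x ∷ []) (encA x ∷ v ∷ i ∷ l ∷ [])
      args x zero       = refl
      args x (suc zero) = refl

      loop : ∀ xs (ys : List B) → ∃[ t ] (i ∷ l ∷ []) ⊢loop hd (var zero) , loopBody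
               from node (encList encA xs) (encList encB ys)
               ⇓ node leaf (encList encB (map h xs ʳ++ ys)) ∣ t
      loop []       ys = _ , stop (⇓hd ⇓var)
      loop (x ∷ xs) ys =
        _ , step (⇓hd ⇓var)
                 (⇓cons (⇓tl (⇓hd ⇓var))
                        (⇓cons (⇓let (⇓hd (⇓hd ⇓var))
                                     (rename-⇓ (args x) (proj₂ (p-computes x))))
                               (⇓tl ⇓var)))
                 (proj₂ (loop xs (h x ∷ ys)))

    applyAll-⇓ : ∀ xs → l ≡ encList encA xs →
                 ∃[ t ] (i ∷ l ∷ []) ⊢ applyAll ⇓ encList encB (reverse (map h xs)) ∣ t
    applyAll-⇓ xs refl =
      _ , ⇓tl (⇓while (⇓cons ⇓var ⇓nil) (proj₂ (loop xs [])))

encList-map : ∀ {A B : Set} (enc : B → Tree) (h : A → B) xs →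
              encList enc (map h xs) ≡ encList (λ x → enc (h x)) xs
encList-map enc h []       = refl
encList-map enc h (x ∷ xs) = cong (node (enc (h x))) (encList-map enc h xs)

applicable : ∀ Φ (g : SolutionMap Φ) →
             ∃ (ComputableFamilyWithin Φ g) → ∃ (ApplicableWithin Φ g)
applicable Φ g (_ , p , p-computes) =
  (λ I S → proj₁ (run I S)) , applyAll p ,
  λ I S → reverse (map (g I) S) , ↭-reverse _ ,
          proj₁ (run I S) , ≤-refl , proj₂ (run I S)
  where
  run : ∀ I S → ∃[ t ] (encBits I ∷ encFamily (elements Φ I S) ∷ []) ⊢ applyAll p
                         ⇓ encFamily (reverse (map (g I) S)) ∣ t
  run I S = applyAll-⇓ p (λ A → encSubset (proj₁ A)) encSubset (g I)
              (λ A → let (t , _ , d) = p-computes I A in t , d)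
              S (encList-map encSubset proj₁ S)

{-# OPTIONS --safe #-}
-- Composing the three programs gives exactly the claimed running time.  Its
-- output is a solution because an isometry between feasible sets preserves every
-- quantity in the definition of the problem, and because the definition does not
-- depend on the order in which a set is listed.
module Submission where

open import Data.Bool.Base using (T)
open import Data.Bool.Properties using (T-irrelevant)
open import Data.Fin.Base using (Fin; zero; suc)
open import Data.Fin.Subset using (∣_∣)
open import Data.List.Base using (List; length; map)
open import Data.List.Membership.Propositional using (_∈_)
open import Data.List.Membership.Propositional.Properties using (∈-map⁺; ∈-map⁻)
open import Data.List.Properties using (length-map; map-cong; map-id; map-∘)
open import Data.List.Relation.Binary.Permutation.Propositional
  using (_↭_; ↭-sym; ↭⇒↭ₛ)
open import Data.List.Relation.Binary.Permutation.Propositional.Properties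
  using (∈-resp-↭; ↭-length; ↭-map-inv)
open import Data.List.Relation.Binary.Permutation.Setoid.Properties
  using (Unique-resp-↭)
import Data.List.Relation.Unary.All as All
import Data.List.Relation.Unary.All.Properties as All
import Data.List.Relation.Unary.Unique.Propositional.Properties as Unique
open import Data.Nat.Base using (ℕ; _+_; _≤_)
open import Data.Nat.Properties using (+-assoc; +-mono-≤)
open import Data.Product.Base using (∃; ∃-syntax; _×_; _,_; proj₁; proj₂)
open import Data.Vec.Base using ([]; _∷_)
open import Data.Vec.Properties using (toList-cast)
open import Function.Base using (_∘_)
open import Function.Bundles using (Inverse; Injection; _↔_; mk⤖)
open import Function.Properties.Bijection using (⤖⇒↔)
open import Function.Properties.Inverse using (↔-sym; ↔⇒↣)
open import Relation.Binary.PropositionalEquality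
  using (_≡_; _≢_; refl; sym; trans; cong; cong₂; subst; setoid)
open import Defs

-- Extrema, and independence of the listing order.

IsMin-resp-⇔ : ∀ {P Q : ℕ → Set} →
               (∀ {k} → P k → Q k) → (∀ {k} → Q k → P k) →
               ∀ {m} → IsMin P m → IsMin Q m
IsMin-resp-⇔ to from (p , min) = to p , min ∘ from

IsMax-resp-⇔ : ∀ {P Q : ℕ → Set} →
               (∀ {k} → P k → Q k) → (∀ {k} → Q k → P k) →
               ∀ {m} → IsMax P m → IsMax Q m
IsMax-resp-⇔ to from (p , max) = to p , max ∘ from

module _ (Φ : SetSystem) (I : Instance) where
  open SetSystem Φ

  -- `Weight`, `Distance` and `MinimaMinPD` restate the predicates inside `IsOPT`, `IsMinPD` and
  -- `IsMaxMinPD`, so that they can be passed explicitly to `IsMin-resp-⇔` and `IsMax-resp-⇔`.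
  Weight : ℕ → Set
  Weight k = ∃[ A ] T (family I A) × k ≡ ∣ A ∣

  Distance : List (Feasible I) → ℕ → Set
  Distance S d = ∃[ z₁ ] ∃[ z₂ ] z₁ ∈ elements Φ I S × z₂ ∈ elements Φ I S ×
                 z₁ ≢ z₂ × d ≡ hamming z₁ z₂

  MinimaMinPD : ℕ → ℕ → Set
  MinimaMinPD s d = ∃[ S ] SubsetOfMinima Φ I s S × IsMinPD (elements Φ I S) d

  -- `T` is proof-irrelevant. This links the inequality of bit strings in `Distance` with
  -- bijections, which act on feasible sets.
  Feasible-≡ : {A B : Feasible I} → proj₁ A ≡ proj₁ B → A ≡ B
  Feasible-≡ {A , p} {_ , q} refl = cong (A ,_) (T-irrelevant p q)

  Distance-resp-↭ : ∀ {S S′ d} → S ↭ S′ → Distance S d → Distance S′ d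
  Distance-resp-↭ S↭S′ (_ , _ , z₁∈ , z₂∈ , rest)
    with A , A∈ , refl ← ∈-map⁻ proj₁ z₁∈
       | B , B∈ , refl ← ∈-map⁻ proj₁ z₂∈ =
    _ , _ , ∈-map⁺ proj₁ (∈-resp-↭ S↭S′ A∈) , ∈-map⁺ proj₁ (∈-resp-↭ S↭S′ B∈) , rest

  IsMinPD-resp-↭ : ∀ {S S′ d} → S ↭ S′ →
                   IsMinPD (elements Φ I S) d → IsMinPD (elements Φ I S′) d
  IsMinPD-resp-↭ S↭S′ = IsMin-resp-⇔ {Distance _} {Distance _}
    (Distance-resp-↭ S↭S′) (Distance-resp-↭ (↭-sym S↭S′))

-- Isometries of feasible sets and their invariants.

record Isometry (Φ : SetSystem) (I : Instance) (Ψ : SetSystem) (J : Instance) : Set where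
  field
    bijection : SetSystem.Feasible Φ I ↔ SetSystem.Feasible Ψ J

  open Inverse bijection public using (to; from; strictlyInverseˡ; strictlyInverseʳ)

  field
    weight    : ∀ A → ∣ proj₁ A ∣ ≡ ∣ proj₁ (to A) ∣
    isometric : ∀ A B → hamming (proj₁ A) (proj₁ B) ≡ hamming (proj₁ (to A)) (proj₁ (to B))

  injective : ∀ {A B} → to A ≡ to B → A ≡ B
  injective = Injection.injective (↔⇒↣ bijection)

  map-from-to : ∀ S → map from (map to S) ≡ S
  map-from-to S =
    trans (sym (map-∘ S)) (trans (map-cong strictlyInverseʳ S) (map-id S))

  -- Closure under inverses lets one proof of a transport lemma serve both directions: once its
  -- module is closed, the lemma applies to `φ` and to `inverse` alike.
  inverse : Isometry Ψ J Φ I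
  inverse = record
    { bijection = ↔-sym bijection
    ; weight    = λ A → sym (trans (weight (from A))
        (cong (∣_∣ ∘ proj₁) (strictlyInverseˡ A)))
    ; isometric = λ A B → sym (trans (isometric (from A) (from B))
        (cong₂ (λ C D → hamming (proj₁ C) (proj₁ D)) (strictlyInverseˡ A) (strictlyInverseˡ B)))
    }

module _ {Φ I Ψ J} (φ : Isometry Φ I Ψ J) where
  open Isometry φ

  Weight-map : ∀ {k} → Weight Φ I k → Weight Ψ J k
  Weight-map (A , p , k≡) = let (B , q) = to (A , p) in B , q , trans k≡ (weight (A , p))

  Distance-map : ∀ {S d} → Distance Φ I S d → Distance Ψ J (map to S) d
  Distance-map (_ , _ , z₁∈ , z₂∈ , z₁≢z₂ , d≡)
    with A , A∈ , refl ← ∈-map⁻ proj₁ z₁∈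
       | B , B∈ , refl ← ∈-map⁻ proj₁ z₂∈ =
    _ , _ , ∈-map⁺ proj₁ (∈-map⁺ to A∈) , ∈-map⁺ proj₁ (∈-map⁺ to B∈) ,
    -- Equal image strings give equal feasible images, hence equal preimages by injectivity.
    (λ eq → z₁≢z₂ (cong proj₁ (injective (Feasible-≡ Ψ J eq)))) ,
    trans d≡ (isometric A B)

module _ {Φ I Ψ J} (φ : Isometry Φ I Ψ J) where
  open Isometry φ

  IsOPT-map : ∀ {k} → IsOPT Φ I k → IsOPT Ψ J k
  IsOPT-map = IsMin-resp-⇔ {Weight Φ I} {Weight Ψ J} (Weight-map φ) (Weight-map inverse)

  -- Transport along `inverse` lands in `map from (map to S)`, which is `S` again.
  Distance-unmap : ∀ {S d} → Distance Ψ J (map to S) d → Distance Φ I S d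
  Distance-unmap {S} {d} =
    subst (λ S′ → Distance Φ I S′ d) (map-from-to S) ∘ Distance-map inverse

  IsMinPD-map : ∀ {S d} → IsMinPD (elements Φ I S) d → IsMinPD (elements Ψ J (map to S)) d
  IsMinPD-map = IsMin-resp-⇔ {Distance Φ I _} {Distance Ψ J _} (Distance-map φ) Distance-unmap

  IsMinPD-unmap : ∀ {S d} → IsMinPD (elements Ψ J (map to S)) d → IsMinPD (elements Φ I S) d
  IsMinPD-unmap = IsMin-resp-⇔ {Distance Ψ J _} {Distance Φ I _} Distance-unmap (Distance-map φ)

  SubsetOfMinima-map : ∀ {s S} → SubsetOfMinima Φ I s S → SubsetOfMinima Ψ J s (map to S)
  SubsetOfMinima-map {S = S} (unique , count , minima) =
    Unique.map⁺ injective unique ,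
    trans (length-map to S) count ,
    All.map⁺ (All.map (λ {A} → subst (IsOPT Ψ J) (weight A) ∘ IsOPT-map) minima)

  MinimaMinPD-map : ∀ {s d} → MinimaMinPD Φ I s d → MinimaMinPD Ψ J s d
  MinimaMinPD-map (S , minima , minPD) =
    map to S , SubsetOfMinima-map minima , IsMinPD-map minPD

module _ {Φ I Ψ J} (φ : Isometry Φ I Ψ J) where
  open Isometry φ

  -- Maximality needs a bound for every family of minima of `J`; each is pulled back along `inverse`
  -- to one of `I` with the same minPD.
  IsMaxMinPD-map : ∀ {s m} → IsMaxMinPD Φ I s m → IsMaxMinPD Ψ J s m
  IsMaxMinPD-map {s} = IsMax-resp-⇔ {MinimaMinPD Φ I s} {MinimaMinPD Ψ J s}
    (MinimaMinPD-map φ) (MinimaMinPD-map inverse)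

-- Transport of diverse solutions.

module _ {c ℓ₁ ℓ₂} (R : OrderedRing c ℓ₁ ℓ₂) {C₁ C₂ : OrderedRing.Carrier R} where
  open OrderedRing R

  IsDiverseSolution-resp-↭ : ∀ {Φ I s S S′} → S ↭ S′ →
    IsDiverseSolution R C₁ C₂ Φ I s S → IsDiverseSolution R C₁ C₂ Φ I s S′
  IsDiverseSolution-resp-↭ {Φ} {I} {S = S} {S′} S↭S′ sol = record
    { distinct = Unique-resp-↭ (setoid _) (↭⇒↭ₛ S↭S′) distinct
    ; count    = trans (sym (↭-length S↭S′)) count
    ; light    = light′
    ; diverse  = diverse ∘ IsMinPD-resp-↭ Φ I (↭-sym S↭S′)
    }
    where
    open IsDiverseSolution sol
    light′ : ∀ {z opt} → z ∈ elements Φ I S′ → IsOPT Φ I opt → ι ∣ z ∣ ≤ᴿ C₁ *ᴿ ι opt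
    light′ z∈ isOPT with A , A∈ , refl ← ∈-map⁻ proj₁ z∈ =
      light (∈-map⁺ proj₁ (∈-resp-↭ (↭-sym S↭S′) A∈)) isOPT

  IsDiverseSolution-map : ∀ {Φ I Ψ J s S} (φ : Isometry Φ I Ψ J) →
    IsDiverseSolution R C₁ C₂ Φ I s S →
    IsDiverseSolution R C₁ C₂ Ψ J s (map (Isometry.to φ) S)
  IsDiverseSolution-map {Ψ = Ψ} {J} {S = S} φ sol = record
    { distinct = Unique.map⁺ injective distinct
    ; count    = trans (length-map to S) count
    ; light    = light′
    -- Both values are given on the target side, so both are pulled back and the inequality itself
    -- is unchanged.
    ; diverse  = λ minPD maxMinPD →
        diverse (IsMinPD-unmap φ minPD) (IsMaxMinPD-map inverse maxMinPD)
    }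
    where
    open IsDiverseSolution sol
    open Isometry φ
    light′ : ∀ {z opt} → z ∈ elements Ψ J (map to S) → IsOPT Ψ J opt →
             ι ∣ z ∣ ≤ᴿ C₁ *ᴿ ι opt
    light′ {opt = opt} z∈ isOPT
      with B , B∈ , refl ← ∈-map⁻ proj₁ z∈
      with A , A∈ , refl ← ∈-map⁻ to B∈ =
      subst (λ w → ι w ≤ᴿ C₁ *ᴿ ι opt) (weight A)
        (light (∈-map⁺ proj₁ A∈) (IsOPT-map inverse isOPT))

-- The isometry points against the reduction, since `g↓` carries solutions of `f I` back to `I`.
reduction-isometry : ∀ {Φ₁ Φ₂} (red : IsometricReduction Φ₁ Φ₂) I →
                     Isometry Φ₂ (IsometricReduction.f red I) Φ₁ I
reduction-isometry red I = record
  { bijection = ⤖⇒↔ (mk⤖ (g-bijective I))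
  ; weight    = g-weight I
  ; isometric = g-isometric I
  }
  where open IsometricReduction red

-- Composition of the programs and the time bound.

-- Naming the two intermediate values by let is free, so there is no overhead.
composition : Exp 1 → Exp 2 → Exp 2 → Exp 2
composition pf p pg = let′ (rename onInstance pf) (let′ (rename onImage p) (rename onBoth pg))
  where
  onInstance : Fin 1 → Fin 2
  onInstance zero = zero

  -- The environment is now the computed instance, the original instance, `s`; the middle entry is
  -- skipped.
  onImage : Fin 2 → Fin 3
  onImage zero       = zero
  onImage (suc zero) = suc (suc zero)

  -- The solution found now stands in front of the computed instance, whereas `pg` expects the
  -- instance first.
  onBoth : Fin 2 → Fin 4
  onBoth zero       = suc zero
  onBoth (suc zero) = zero

composition-runs : ∀ {pf p pg i j s u v b₁ b₂ b₃} →
  RunsWithin pf (i ∷ []) j b₁ → RunsWithin p (j ∷ s ∷ []) u b₂ →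
  RunsWithin pg (j ∷ u ∷ []) v b₃ →
  RunsWithin (composition pf p pg) (i ∷ s ∷ []) v (b₁ + b₂ + b₃)
composition-runs {b₁ = b₁} {b₂} {b₃} (t₁ , t₁≤ , r₁) (t₂ , t₂≤ , r₂) (t₃ , t₃≤ , r₃) =
  t₁ + (t₂ + t₃) ,
  subst (t₁ + (t₂ + t₃) ≤_) (sym (+-assoc b₁ b₂ b₃)) (+-mono-≤ t₁≤ (+-mono-≤ t₂≤ t₃≤)) ,
  ⇓let (rename-⇓ (λ { zero → refl }) r₁)
    (⇓let (rename-⇓ (λ { zero → refl ; (suc zero) → refl }) r₂)
      (rename-⇓ (λ { zero → refl ; (suc zero) → refl }) r₃))

-- The cast along `size-≡` leaves the underlying list of bits unchanged, so the output of `pg`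
-- already encodes sets of `Φ₁` and no conversion time arises.
encFamily-g↓ : ∀ {Φ₁ Φ₂} (red : IsometricReduction Φ₁ Φ₂) →
  let open IsometricReduction red in
  ∀ I S → encFamily (map (g (f I)) S) ≡ encFamily (elements Φ₁ I (map (g↓ I) S))
encFamily-g↓ red I List.[]      = refl
encFamily-g↓ red I (A List.∷ S) =
  cong₂ node (cong encBits (sym (toList-cast (size-≡ I) (g (f I) A)))) (encFamily-g↓ red I S)
  where open IsometricReduction red

theorem35 : ∀ {c ℓ₁ ℓ₂} (R : OrderedRing c ℓ₁ ℓ₂) → let open OrderedRing R in
    (C₁ C₂ : Carrier) → 1# ≤ᴿ C₁ → C₂ ≤ᴿ 1# →
    (Φ₁ Φ₂ : SetSystem) → let open SetSystem in
    (red : IsometricReduction Φ₁ Φ₂) → let open IsometricReduction red in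
    (τf : Instance → ℕ) → ComputableWithin f τf →
    (τg : (I : Instance) → List (Feasible Φ₂ I) → ℕ) → ApplicableWithin Φ₂ g τg →
    (τ : ℕ → ℕ → ℕ → ℕ) →
    (alg : DiverseAlgorithm R C₁ C₂ Φ₂ (λ I s → τ (size Φ₂ I) s (length I))) →
    let open DiverseAlgorithm alg using (output) in
    DiverseAlgorithm R C₁ C₂ Φ₁
    (λ I₁ s → let I₂ = f I₁ in
    τf I₁ + τ (size Φ₁ I₁) s (length I₂) + τg I₂ (output I₂ s))
theorem35 R C₁ C₂ _ _ Φ₁ Φ₂ red τf (pf , f-runs) τg (pg , g-runs) τ alg = record
  { program = composition pf program pg
  ; output  = λ I s → map (g↓ I) (S′ I s)
  ; runs    = λ I s minima → composition-runs (f-runs I)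
      -- The given bound is in terms of the size of `f I`, the claimed one in terms of that of `I`.
      (subst (λ n → RunsWithin program _ _ (τ n s (length (f I)))) (size-≡ I)
        (runs (f I) s (minima₂ I minima)))
      (subst (λ u → RunsWithin pg _ u (τg (f I) (output (f I) s)))
        (trans (cong encFamily (U≡ I s)) (encFamily-g↓ red I (S′ I s)))
        (proj₂ (proj₂ (g-runs (f I) (output (f I) s)))))
  ; correct = λ I s minima → IsDiverseSolution-map R (isometry I)
      (IsDiverseSolution-resp-↭ R (S↭S′ I s) (correct (f I) s (minima₂ I minima)))
  }
  where
  open IsometricReduction red
  open DiverseAlgorithm alg

  isometry : ∀ I → Isometry Φ₂ (f I) Φ₁ I
  isometry = reduction-isometry red

  -- The algorithm for `Φ₂` promises something only if `s` minimum-weight solutions exist, so their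
  -- existence is carried from `I` to `f I`.
  minima₂ : ∀ I {s} → ∃ (SubsetOfMinima Φ₁ I s) → ∃ (SubsetOfMinima Φ₂ (f I) s)
  minima₂ I (_ , minima) = _ , SubsetOfMinima-map (Isometry.inverse (isometry I)) minima

  -- The images are listed in the order chosen by pg; S′ lists the solution of
  -- f I in the corresponding order.
  reordered : ∀ I s → let (U , _) = g-runs (f I) (output (f I) s) in
              ∃[ S′ ] U ≡ map (g (f I)) S′ × output (f I) s ↭ S′
  reordered I s = ↭-map-inv (g (f I)) (↭-sym (proj₁ (proj₂ (g-runs (f I) (output (f I) s)))))

  S′ : ∀ I s → List (SetSystem.Feasible Φ₂ (f I))
  S′ I s = proj₁ (reordered I s)

  U≡ : ∀ I s → proj₁ (g-runs (f I) (output (f I) s)) ≡ map (g (f I)) (S′ I s)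
  U≡ I s = proj₁ (proj₂ (reordered I s))

  S↭S′ : ∀ I s → output (f I) s ↭ S′ I s
  S↭S′ I s = proj₂ (proj₂ (reordered I s))
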